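{- Let $N\ge 5$ be an integer, and write $N=3k+i$ with $k\in\mathbb{N}$ and $i\in\{0,1,2\}$. Let $SP^N_*$ denote the maximal number of finite paths ending in the sink, over all connected acyclic directed graphs with exactly $N$ edges and exactly one sink. Then $$SP^N_*=\begin{cases}\frac12\left(11\cdot 3^{k-1}-1\right) & \text{if } i=0,\\[2pt] \frac12\left(47\cdot 3^{k-2}-1\right) & \text{if } i=1,\\[2pt] \frac12\left(23\cdot 3^{k-1}-1\right) & \text{if } i=2.\end{cases}$$
   Context: A directed graph $E=(E^0,E^1,s_E,t_E)$ consists of a set of vertices $E^0$, a set of edges $E^1$, and source and target maps $s_E,t_E\colon E^1\to E^0$ (multiple edges are allowed). A finite path of length $n\ge1$ is a tuple $(e_1,\dots,e_n)$ of edges with $t_E(e_i)=s_E(e_{i+1})$ for $1\le i<n$; it ends at $t_E(e_n)$. Vertices are paths of length $0$, ending at themselves. $E$ is acyclic if it has no path of positive length whose beginning and end coincide; $E$ is connected if any two vertices are joined by a finite undirected path. A sink is a vertex emitting no edges. -}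

module Defs where

open import Data.Fin.Base using (Fin)
open import Data.Fin.Patterns using (0F; 1F; 2F)
open import Data.Nat.Base using (ℕ; _*_; _∸_; _^_; _≤_)
open import Data.Nat.DivMod using (_/_)
open import Data.Product using (Σ; ∃; ∃!; _×_; proj₁)
open import Function.Bundles using (_↔_; _↣_)
open import Relation.Binary.Construct.Closure.Equivalence using (EqClosure)
open import Relation.Binary.Construct.Closure.ReflexiveTransitive using (Star)
open import Relation.Binary.Construct.Closure.Transitive using (TransClosure)
open import Relation.Binary.PropositionalEquality using (_≡_)
open import Relation.Nullary.Negation using (¬_)

record Digraph : Set₁ where
  field
    Vertex : Set
    Edge   : Set
    source : Edge → Vertex
    target : Edge → Vertex

  -- Proof-relevant: parallel edges give different elements of u ⟶ v.
  _⟶_ : Vertex → Vertex → Set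
  u ⟶ v = ∃ λ e → source e ≡ u × target e ≡ v

  -- Elements are tuples of composable edges (ε at v is the vertex v, of
  -- length 0).  Axiom K holds here, so the equations stored in _⟶_ do not
  -- affect equality: two paths are equal exactly when their edges are.
  Path : Vertex → Vertex → Set
  Path = Star _⟶_

  PathEndingAt : Vertex → Set
  PathEndingAt v = ∃ λ u → Path u v

  Acyclic : Set
  Acyclic = ∀ v → ¬ TransClosure _⟶_ v v

  Connected : Set
  Connected = ∀ u v → EqClosure _⟶_ u v

  IsSink : Vertex → Set
  IsSink v = ¬ (∃ λ e → source e ≡ v)

open Digraph using (Edge; PathEndingAt; Acyclic; Connected; IsSink)

record Admissible (N : ℕ) (E : Digraph) : Set where
  field
    edges     : Fin N ↔ Edge E
    connected : Connected E
    acyclic   : Acyclic E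
    oneSink   : ∃! _≡_ (IsSink E)

  sink : Digraph.Vertex E
  sink = proj₁ oneSink

open Admissible using (sink)

-- M is the maximal number of paths ending in the sink.  The bound is phrased
-- with injections so that finiteness of the set of paths of an arbitrary
-- admissible graph is part of the claim and not a hypothesis.
record IsMaxPathsToSink (N M : ℕ) : Set₁ where
  field
    attained : Σ Digraph λ E → Σ (Admissible N E) λ a →
               Fin M ↔ PathEndingAt E (sink a)
    bounded  : (E : Digraph) (a : Admissible N E) (m : ℕ) →
               Fin m ↣ PathEndingAt E (sink a) → m ≤ M

-- The numerators are even, and for 3k + i ≥ 5 we have k ≥ 1, and k ≥ 2 unless
-- i = 2; so division and truncated subtraction are exact in that range.
maxPathsFormula : ℕ → Fin 3 → ℕ
maxPathsFormula k 0F = (11 * 3 ^ (k ∸ 1) ∸ 1) / 2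
maxPathsFormula k 1F = (47 * 3 ^ (k ∸ 2) ∸ 1) / 2
maxPathsFormula k 2F = (23 * 3 ^ (k ∸ 1) ∸ 1) / 2

{-# OPTIONS --safe #-}
module Submission where

-- For a vertex v let p v be the number of paths from v to the sink.  At the
-- sink p is 1, and at every other vertex p is the sum of p (target e) over
-- the edges e leaving v.  Splitting off first edges, the number of paths
-- ending in the sink is 1 plus the sum of p (target e) over all edges e.
--
-- Upper bound.  Process the vertices starting from the sink, each after all
-- its successors.  If p ≤ M on the processed vertices, where M ≥ 1, then a new
-- vertex with d edges has p ≤ d * M, and its edges contribute at most d * M to
-- the sum.  So the best total f N with N edges is governed by the recursion
-- f N = max { 1 + d * f (N - d) : 1 ≤ d ≤ N }, f 0 = 1.  It is solved by
-- `maxPaths`, for which 1 + d * f n ≤ f (d + n) is `maxPaths-+`; the induction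
-- over the unprocessed edges is `total-bound`.  It needs only that p is
-- bounded at each vertex by 1 or by the sum over the outgoing edges, so p may
-- be replaced by the number of paths of length less than a fixed ℓ.  Given m
-- distinct paths, ℓ is chosen at least as large as their lengths, and recording
-- a path by its list of edges injects the m paths into a list of length at most
-- f N.
--
-- The vertices of an arbitrary graph need not have decidable equality.  But by
-- connectedness every vertex is the sink or an endpoint of one of the N edges,
-- so equality is decidable up to double negation, which suffices because
-- m ≤ f N is a stable proposition.
--
-- Attainment.  Adding a new sink and d ≥ 1 parallel edges to it from the old
-- sink turns M paths into 1 + d * M (`attained-+`).  With d = 3 this is the
-- step maxPaths (3 + n) = 1 + 3 * maxPaths n, valid for n ≥ 5; the smaller
-- values arise similarly with d = 1, 2 or 3.
--
-- Closed form.  Each such step multiplies 2 * maxPaths n + 1 by 3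
-- (`maxPaths-closed`), starting from 23, 33 and 47 at n = 5, 6 and 7.

open import Defs
open import Data.Fin.Base using (Fin; toℕ)
open import Data.Nat.Base using (ℕ; _+_; _*_; _≤_)
open import Relation.Binary.PropositionalEquality using (_≡_)

open import Data.Fin.Base using (zero)
open import Data.Fin.Induction using (spo-wellFounded)
open import Data.Fin.Patterns using (0F; 1F; 2F)
open import Data.Fin.Properties using (+↔⊎; *↔×; injective⇒≤)
open import Data.List.Base
  using (List; []; _∷_; _++_; map; concatMap; filter; length; tabulate)
open import Data.List.Extrema.Nat using (max; xs≤max)
open import Data.List.Membership.Propositional using (_∈_; find; lose)
open import Data.List.Membership.Propositional.Properties
  using (∈-++⁺ˡ; ∈-++⁺ʳ; ∈-concatMap⁺; ∈-filter⁺; ∈-filter⁻; ∈-map⁺; ∈-tabulate⁺)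
open import Data.List.Membership.Setoid.Properties using (index-injective)
open import Data.List.Properties
  using (filter-accept; filter-none; filter-notAll; filter-reject; filter-some;
         length-++; length-map; length-tabulate; map-++; ∷-injective)
open import Data.List.Relation.Binary.Permutation.Propositional
  using (_↭_; ↭-refl; ↭-prep; ↭-sym; ↭-trans)
open import Data.List.Relation.Binary.Permutation.Propositional.Properties
  using (map⁺; shift; ↭-length)
open import Data.List.Relation.Unary.All as All using (All)
open import Data.List.Relation.Unary.All.Properties using (tabulate⁻)
open import Data.List.Relation.Unary.Any as Any using (here; there; any?)
open import Data.Maybe.Base using (Maybe; just; nothing)
open import Data.Nat.Base using (zero; suc; _∸_; _^_; _/_; _<_; z≤n; s≤s)
open import Data.Nat.DivMod using (m*n/n≡m)
open import Data.Nat.Induction using (<-wellFounded)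
open import Data.Nat.ListAction using (sum)
open import Data.Nat.ListAction.Properties using (sum-++; sum-↭)
open import Data.Nat.Properties
open import Data.Nat.Tactic.RingSolver using (solve-∀)
open import Data.Product using (Σ; ∃!; _×_; _,_; proj₁; proj₂; ∃-syntax)
open import Data.Product.Function.NonDependent.Propositional using (_×-↔_)
open import Data.Sum.Base using (_⊎_; inj₁; inj₂)
open import Data.Sum.Function.Propositional using (_⊎-↔_)
open import Data.Unit.Base using (⊤; tt)
open import Function.Base using (_∘_)
open import Function.Bundles using (_↔_; _↣_; Inverse; Injection; mk↔ₛ′)
open import Function.Properties.Inverse using (↔-refl; ↔-trans)
open import Induction.WellFounded using (Acc; acc; WellFounded)
open import Level using (0ℓ)
open import Relation.Binary.Construct.Closure.Equivalence as EqClosure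
  using (EqClosure)
open import Relation.Binary.Construct.Closure.ReflexiveTransitive using (ε; _◅_)
open import Relation.Binary.Construct.Closure.Symmetric using (fwd; bwd)
open import Relation.Binary.Construct.Closure.Transitive as Trans
  using (TransClosure; [_]; _∷_)
open import Relation.Binary.Definitions using (DecidableEquality)
open import Relation.Binary.PropositionalEquality
  using (refl; sym; trans; cong; cong₂; subst; subst₂; setoid; isEquivalence;
         module ≡-Reasoning)
open import Relation.Nullary.Decidable
  using (yes; no; ¬?; decidable-stable; ¬¬-excluded-middle)
open import Relation.Nullary.Negation
  using (¬_; contradiction; ¬¬-map; ¬¬-Monad)
open import Relation.Unary using (Pred; Decidable; _⊆_)

open Digraph using (Vertex; Edge; PathEndingAt; Acyclic; Connected; IsSink)
open Admissible using (sink)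

private
  variable
    A : Set

-- The arithmetic of the extremal numbers

-- The solution f of f N = max { 1 + d * f (N - d) : 1 ≤ d ≤ N }, f 0 = 1.
-- From N = 8 on, d = 3 is optimal.
maxPaths : ℕ → ℕ
maxPaths 0 = 1
maxPaths 1 = 2
maxPaths 2 = 3
maxPaths 3 = 5
maxPaths 4 = 7
maxPaths 5 = 11
maxPaths 6 = 16
maxPaths 7 = 23
maxPaths (suc (suc (suc n@(suc (suc (suc (suc (suc _)))))))) =
  suc (3 * maxPaths n)

maxPaths-+1 : ∀ n → 1 + maxPaths n ≤ maxPaths (1 + n)
maxPaths-+1 0 = ≤ᵇ⇒≤ _ _ _
maxPaths-+1 1 = ≤ᵇ⇒≤ _ _ _
maxPaths-+1 2 = ≤ᵇ⇒≤ _ _ _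
maxPaths-+1 3 = ≤ᵇ⇒≤ _ _ _
maxPaths-+1 4 = ≤ᵇ⇒≤ _ _ _
maxPaths-+1 5 = ≤ᵇ⇒≤ _ _ _
maxPaths-+1 6 = ≤ᵇ⇒≤ _ _ _
maxPaths-+1 7 = ≤ᵇ⇒≤ _ _ _
maxPaths-+1 (suc (suc (suc n@(suc (suc (suc (suc (suc _)))))))) = begin
  1 + (1 + 3 * a)          ≤⟨ n≤1+n _ ⟩
  1 + (1 + (1 + 3 * a))    ≡⟨ identity a ⟩
  3 * (1 + a)              ≤⟨ *-monoʳ-≤ 3 (maxPaths-+1 n) ⟩
  3 * maxPaths (1 + n)     ≤⟨ n≤1+n _ ⟩
  1 + 3 * maxPaths (1 + n) ∎
  where
  open ≤-Reasoning
  a = maxPaths n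
  identity : ∀ x → 1 + (1 + (1 + 3 * x)) ≡ 3 * (1 + x)
  identity = solve-∀

maxPaths-+2 : ∀ n → 1 + 2 * maxPaths n ≤ maxPaths (2 + n)
maxPaths-+2 0 = ≤ᵇ⇒≤ _ _ _
maxPaths-+2 1 = ≤ᵇ⇒≤ _ _ _
maxPaths-+2 2 = ≤ᵇ⇒≤ _ _ _
maxPaths-+2 3 = ≤ᵇ⇒≤ _ _ _
maxPaths-+2 4 = ≤ᵇ⇒≤ _ _ _
maxPaths-+2 5 = ≤ᵇ⇒≤ _ _ _
maxPaths-+2 6 = ≤ᵇ⇒≤ _ _ _
maxPaths-+2 7 = ≤ᵇ⇒≤ _ _ _
maxPaths-+2 (suc (suc (suc n@(suc (suc (suc (suc (suc _)))))))) = begin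
  1 + 2 * (1 + 3 * a)      ≡⟨ identity a ⟩
  3 * (1 + 2 * a)          ≤⟨ *-monoʳ-≤ 3 (maxPaths-+2 n) ⟩
  3 * maxPaths (2 + n)     ≤⟨ n≤1+n _ ⟩
  1 + 3 * maxPaths (2 + n) ∎
  where
  open ≤-Reasoning
  a = maxPaths n
  identity : ∀ x → 1 + 2 * (1 + 3 * x) ≡ 3 * (1 + 2 * x)
  identity = solve-∀

maxPaths-+3 : ∀ n → 1 + 3 * maxPaths n ≤ maxPaths (3 + n)
maxPaths-+3 0 = ≤ᵇ⇒≤ _ _ _
maxPaths-+3 1 = ≤ᵇ⇒≤ _ _ _
maxPaths-+3 2 = ≤ᵇ⇒≤ _ _ _
maxPaths-+3 3 = ≤ᵇ⇒≤ _ _ _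
maxPaths-+3 4 = ≤ᵇ⇒≤ _ _ _
maxPaths-+3 (suc (suc (suc (suc (suc _))))) = ≤-refl

-- From d ≥ 2 to d + 2 it suffices to use maxPaths-+2, because 2 + d ≤ 2 * d;
-- this fails for d = 1, so d = 1, 2, 3 are the base cases.
maxPaths-+ : ∀ d n → 1 ≤ d → 1 + d * maxPaths n ≤ maxPaths (d + n)
maxPaths-+ 1 n _ =
  subst (λ x → 1 + x ≤ maxPaths (1 + n)) (sym (*-identityˡ (maxPaths n))) (maxPaths-+1 n)
maxPaths-+ 2 n _ = maxPaths-+2 n
maxPaths-+ 3 n _ = maxPaths-+3 n
maxPaths-+ (suc (suc d@(suc (suc _)))) n _ = begin
  1 + (2 + d) * a          ≡⟨ cong suc (*-distribʳ-+ a 2 d) ⟩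
  1 + (2 * a + d * a)      ≤⟨ s≤s (+-monoˡ-≤ (d * a) (*-monoˡ-≤ a 2≤d)) ⟩
  1 + (d * a + d * a)      ≤⟨ m≤n+m _ 2 ⟩
  3 + (d * a + d * a)      ≡⟨ identity (d * a) ⟩
  1 + 2 * (1 + d * a)      ≤⟨ s≤s (*-monoʳ-≤ 2 (maxPaths-+ d n (s≤s z≤n))) ⟩
  1 + 2 * maxPaths (d + n) ≤⟨ maxPaths-+2 (d + n) ⟩
  maxPaths (2 + (d + n))   ∎
  where
  open ≤-Reasoning
  a = maxPaths n
  2≤d : 2 ≤ d
  2≤d = s≤s (s≤s z≤n)
  identity : ∀ x → 3 + (x + x) ≡ 1 + 2 * (1 + x)
  identity = solve-∀

-- The step x ↦ 1 + 3 * x multiplies 2 * x + 1 by 3.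
maxPaths-closed : ∀ c m → maxPaths (5 + m) * 2 + 1 ≡ c → ∀ j →
                  maxPaths (5 + (3 * j + m)) * 2 + 1 ≡ c * 3 ^ j
maxPaths-closed c m eq zero    = trans eq (sym (*-identityʳ c))
maxPaths-closed c m eq (suc j) = begin
  maxPaths (5 + (3 * suc j + m)) * 2 + 1
    ≡⟨ cong (λ x → maxPaths (5 + (x + m)) * 2 + 1) (*-suc 3 j) ⟩
  (1 + 3 * a) * 2 + 1
    ≡⟨ identity a ⟩
  3 * (a * 2 + 1)
    ≡⟨ cong (3 *_) (maxPaths-closed c m eq j) ⟩
  3 * (c * 3 ^ j)
    ≡⟨ swap c (3 ^ j) ⟩
  c * (3 * 3 ^ j) ∎
  where
  open ≡-Reasoning
  a = maxPaths (5 + (3 * j + m))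
  identity : ∀ x → (1 + 3 * x) * 2 + 1 ≡ 3 * (x * 2 + 1)
  identity = solve-∀
  swap : ∀ x y → 3 * (x * y) ≡ x * (3 * y)
  swap = solve-∀

half : ∀ a b → a * 2 + 1 ≡ b → a ≡ (b ∸ 1) / 2
half a .(a * 2 + 1) refl = sym (begin
  (a * 2 + 1 ∸ 1) / 2 ≡⟨ cong (_/ 2) (m+n∸n≡m (a * 2) 1) ⟩
  a * 2 / 2           ≡⟨ m*n/n≡m a 2 ⟩
  a                   ∎)
  where open ≡-Reasoning

maxPaths≡formula : ∀ k i → 5 ≤ 3 * k + toℕ i →
                   maxPaths (3 * k + toℕ i) ≡ maxPathsFormula k i
maxPaths≡formula 0 0F ()
maxPaths≡formula 0 1F (s≤s ())
maxPaths≡formula 0 2F (s≤s (s≤s ()))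
maxPaths≡formula 1 0F (s≤s (s≤s (s≤s ())))
maxPaths≡formula 1 1F (s≤s (s≤s (s≤s (s≤s ()))))
maxPaths≡formula (suc (suc j)) 0F _ = half _ _ (begin
  maxPaths (3 * (2 + j) + 0) * 2 + 1 ≡⟨ cong (λ x → maxPaths x * 2 + 1) (index j) ⟩
  maxPaths (5 + (3 * j + 1)) * 2 + 1 ≡⟨ maxPaths-closed 33 1 refl j ⟩
  33 * 3 ^ j                         ≡⟨ *-assoc 11 3 (3 ^ j) ⟩
  11 * 3 ^ suc j                     ∎)
  where
  open ≡-Reasoning
  index : ∀ j → 3 * (2 + j) + 0 ≡ 5 + (3 * j + 1)
  index = solve-∀
maxPaths≡formula (suc (suc j)) 1F _ = half _ _ (begin
  maxPaths (3 * (2 + j) + 1) * 2 + 1 ≡⟨ cong (λ x → maxPaths x * 2 + 1) (index j) ⟩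
  maxPaths (5 + (3 * j + 2)) * 2 + 1 ≡⟨ maxPaths-closed 47 2 refl j ⟩
  47 * 3 ^ j                         ∎)
  where
  open ≡-Reasoning
  index : ∀ j → 3 * (2 + j) + 1 ≡ 5 + (3 * j + 2)
  index = solve-∀
maxPaths≡formula (suc j) 2F _ = half _ _ (begin
  maxPaths (3 * (1 + j) + 2) * 2 + 1 ≡⟨ cong (λ x → maxPaths x * 2 + 1) (index j) ⟩
  maxPaths (5 + (3 * j + 0)) * 2 + 1 ≡⟨ maxPaths-closed 23 0 refl j ⟩
  23 * 3 ^ j                         ∎)
  where
  open ≡-Reasoning
  index : ∀ j → 3 * (1 + j) + 2 ≡ 5 + (3 * j + 0)
  index = solve-∀

-- Splitting a list by a decidable predicate

module _ {P : Pred A 0ℓ} (P? : Decidable P) where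

  filter-↭ : ∀ xs → xs ↭ filter P? xs ++ filter (¬? ∘ P?) xs
  filter-↭ []       = ↭-refl
  filter-↭ (x ∷ xs) with P? x
  ... | yes _ = ↭-prep x (filter-↭ xs)
  ... | no  _ = ↭-trans (↭-prep x (filter-↭ xs)) (↭-sym (shift x (filter P? xs) _))

  filter-absorb : {Q : Pred A 0ℓ} (Q? : Decidable Q) → P ⊆ Q →
                  ∀ xs → filter P? (filter Q? xs) ≡ filter P? xs
  filter-absorb Q? P⊆Q [] = refl
  filter-absorb Q? P⊆Q (x ∷ xs) with P? x
  ... | yes p rewrite filter-accept Q? {xs = xs} (P⊆Q p)
                    | filter-accept P? {xs = filter Q? xs} p =
    cong (x ∷_) (filter-absorb Q? P⊆Q xs)
  ... | no ¬p with Q? x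
  ...   | yes _ rewrite filter-reject P? {xs = filter Q? xs} ¬p = filter-absorb Q? P⊆Q xs
  ...   | no  _ = filter-absorb Q? P⊆Q xs

  sum-filter : ∀ (f : A → ℕ) xs →
    sum (map f xs) ≡ sum (map f (filter P? xs)) + sum (map f (filter (¬? ∘ P?) xs))
  sum-filter f xs = begin
    sum (map f xs)               ≡⟨ sum-↭ (map⁺ f (filter-↭ xs)) ⟩
    sum (map f (ys ++ zs))       ≡⟨ cong sum (map-++ f ys zs) ⟩
    sum (map f ys ++ map f zs)   ≡⟨ sum-++ (map f ys) (map f zs) ⟩
    sum (map f ys) + sum (map f zs) ∎
    where
    open ≡-Reasoning
    ys = filter P? xs
    zs = filter (¬? ∘ P?) xs

  length-filter-split : ∀ xs →
    length xs ≡ length (filter P? xs) + length (filter (¬? ∘ P?) xs)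
  length-filter-split xs =
    trans (↭-length (filter-↭ xs)) (length-++ (filter P? xs))

sum-map-≤ : ∀ {f g : A → ℕ} → (∀ x → f x ≤ g x) → ∀ xs → sum (map f xs) ≤ sum (map g xs)
sum-map-≤ f≤g []       = z≤n
sum-map-≤ f≤g (x ∷ xs) = +-mono-≤ (f≤g x) (sum-map-≤ f≤g xs)

sum-map-≤-const : ∀ {f : A → ℕ} b xs → (∀ {x} → x ∈ xs → f x ≤ b) →
                  sum (map f xs) ≤ length xs * b
sum-map-≤-const b []       f≤b = z≤n
sum-map-≤-const b (x ∷ xs) f≤b =
  +-mono-≤ (f≤b (here refl)) (sum-map-≤-const b xs (f≤b ∘ there))


-- Well-foundedness of finite acyclic graphs

-- A strict order on finitely many edges is well-founded; this transfers to
-- vertices because a step from a vertex ends at the target of an edge.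
module WellFoundedness {N} (E : Digraph) (edges : Fin N ↔ Edge E) (acyclic : Acyclic E) where

  open Digraph E
  open Inverse edges using (to; from; strictlyInverseˡ)

  -- i ⊏ j: the source of i is reached from the source of j by a path of
  -- positive length.
  _⊏_ : Fin N → Fin N → Set
  i ⊏ j = TransClosure _⟶_ (source (to j)) (source (to i))

  ⊏-wellFounded : WellFounded _⊏_
  ⊏-wellFounded = spo-wellFounded record
    { isEquivalence = isEquivalence
    ; irrefl        = λ { {i} refl i⊏i → acyclic (source (to i)) i⊏i }
    ; trans         = λ i⊏j j⊏k → j⊏k Trans.++ i⊏j
    ; <-resp-≈      = (λ { refl i⊏j → i⊏j }) , (λ { refl i⊏j → i⊏j })
    }

  target-acc : ∀ i → Acc _⊏_ i → Acc (λ u v → v ⟶ u) (target (to i))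
  target-acc i (acc rec) = acc λ where
    (e , e-from-ti , refl) →
      let to-from = strictlyInverseˡ e in
      subst (λ f → Acc _ (target f)) to-from
        (target-acc (from e)
          (rec [ to i , refl , sym (trans (cong source to-from) e-from-ti) ]))

  ⟵-wellFounded : WellFounded (λ u v → v ⟶ u)
  ⟵-wellFounded v = acc λ where
    (e , _ , refl) → subst (λ f → Acc _ (target f)) (strictlyInverseˡ e)
                       (target-acc (from e) (⊏-wellFounded (from e)))

-- The bound for subharmonic functions

module Subharmonic
  (E : Digraph) (_≟_ : DecidableEquality (Vertex E)) (edges : List (Edge E))
  (⟵-wellFounded : WellFounded (λ u v → Digraph._⟶_ E v u))
  where

  open Digraph E using (_⟶_; source; target)

  from? : ∀ v → Decidable (λ e → source e ≡ v)
  from? v e = source e ≟ v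

  out : Vertex E → List (Edge E)
  out v = filter (from? v) edges

  -- Edges leaving v that belong to R are not followed by edges of R.
  Last : List (Edge E) → Vertex E → Set
  Last R v = ∀ {e f} → e ∈ R → source e ≡ v → f ∈ R → ¬ source f ≡ target e

  -- Follow edges of R as long as possible; this stops by well-foundedness.
  last-source : ∀ R {e} → e ∈ R → ∃[ f ] f ∈ R × Last R (source f)
  last-source R {e} e∈R = go e∈R (⟵-wellFounded (source e))
    where
    go : ∀ {e} → e ∈ R → Acc (λ u v → v ⟶ u) (source e) →
         ∃[ f ] f ∈ R × Last R (source f)
    go {e} e∈R (acc rec)
      with any? (λ g → any? (from? (target g)) R) (filter (from? (source e)) R)
    ... | no none = e , e∈R , λ g∈R g-from-e h∈R h-from-g →
      none (lose (∈-filter⁺ (from? (source e)) g∈R g-from-e) (lose h∈R h-from-g))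
    ... | yes found with find found
    ...   | g , g∈ , next with find next | ∈-filter⁻ (from? (source e)) {xs = R} g∈
    ...     | h , h∈R , h-from-g | _ , g-from-e =
      go h∈R (rec (g , g-from-e , sym h-from-g))

  -- At each vertex p is at most 1, or at most the sum of p over the successors,
  -- counted with multiplicity.
  module _ (p : Vertex E → ℕ)
           (subharmonic : ∀ v → p v ≤ 1 ⊎ p v ≤ sum (map (p ∘ target) (out v)))
    where

    -- R consists of the edges not yet processed.  The hypothesis says that p is
    -- at most M at each vertex, unless R still contains all edges leaving it.
    -- The edges leaving a vertex are processed together, after the edges
    -- leaving its successors, and M grows by the factor d, their number.
    total-bound : ∀ R M → 1 ≤ M →
      (∀ v → p v ≤ M ⊎ filter (from? v) R ≡ out v) →
      sum (map (p ∘ target) R) + M ≤ M * maxPaths (length R)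
    total-bound R = go R (<-wellFounded (length R))
      where
      go : ∀ R → Acc _<_ (length R) → ∀ M → 1 ≤ M →
        (∀ v → p v ≤ M ⊎ filter (from? v) R ≡ out v) →
        sum (map (p ∘ target) R) + M ≤ M * maxPaths (length R)
      go []        _         M 1≤M inv = ≤-reflexive (sym (*-identityʳ M))
      go R@(_ ∷ _) (acc rec) M 1≤M inv with last-source R (here refl)
      ... | e , e∈R , last = begin
        sum (map q R) + M             ≡⟨ cong (_+ M) (sum-filter (from? v) q R) ⟩
        sum (map q C) + sum (map q R′) + M
          ≤⟨ +-monoˡ-≤ M (+-monoˡ-≤ (sum (map q R′)) q-on-C) ⟩
        d * M + sum (map q R′) + M    ≡⟨ cong (_+ M) (+-comm (d * M) _) ⟩
        sum (map q R′) + d * M + M    ≤⟨ +-monoˡ-≤ M (go R′ (rec R′<R) (d * M) 1≤dM inv′) ⟩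
        d * M * maxPaths r + M        ≡⟨ identity d M (maxPaths r) ⟩
        M * (1 + d * maxPaths r)      ≤⟨ *-monoʳ-≤ M (maxPaths-+ d r 1≤d) ⟩
        M * maxPaths (d + r)          ≡⟨ cong (λ n → M * maxPaths n) (length-filter-split (from? v) R) ⟨
        M * maxPaths (length R)       ∎
        where
        open ≤-Reasoning
        v  = source e
        q  = p ∘ target
        C  = filter (from? v) R
        R′ = filter (¬? ∘ from? v) R
        d  = length C
        r  = length R′

        identity : ∀ a b c → a * b * c + b ≡ b * (1 + a * c)
        identity = solve-∀

        1≤d : 1 ≤ d
        1≤d = filter-some (from? v) (lose e∈R refl)

        M≤dM : M ≤ d * M
        M≤dM = ≤-trans (≤-reflexive (sym (*-identityˡ M))) (*-monoˡ-≤ M 1≤d)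

        1≤dM : 1 ≤ d * M
        1≤dM = ≤-trans 1≤M M≤dM

        R′<R : r < length R
        R′<R = filter-notAll (¬? ∘ from? v) R (lose e∈R (λ ¬refl → ¬refl refl))

        -- If R still contains all edges leaving target f, then there are none,
        -- because v is last in R.
        p-target-≤ : ∀ {f} → f ∈ C → p (target f) ≤ M
        p-target-≤ {f} f∈C with ∈-filter⁻ (from? v) {xs = R} f∈C | inv (target f)
        ... | _         | inj₁ p≤M = p≤M
        ... | f∈R , f-from-v | inj₂ eq with subharmonic (target f)
        ...   | inj₁ p≤1 = ≤-trans p≤1 1≤M
        ...   | inj₂ p≤∑ = ≤-trans (subst (λ xs → _ ≤ sum (map q xs)) out-empty p≤∑) z≤n
          where
          out-empty : out (target f) ≡ []
          out-empty = trans (sym eq)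
            (filter-none (from? (target f)) (All.tabulate (last f∈R f-from-v)))

        q-on-C : sum (map q C) ≤ d * M
        q-on-C = sum-map-≤-const M C p-target-≤

        inv′ : ∀ u → p u ≤ d * M ⊎ filter (from? u) R′ ≡ out u
        inv′ u with inv u
        ... | inj₁ p≤M = inj₁ (≤-trans p≤M M≤dM)
        ... | inj₂ eq with v ≟ u
        ...   | no v≢u = inj₂ (trans
          (filter-absorb (from? u) (¬? ∘ from? v)
            (λ f-from-u f-from-v → v≢u (trans (sym f-from-v) f-from-u)) R) eq)
        ...   | yes refl with subharmonic v
        ...     | inj₁ p≤1 = inj₁ (≤-trans p≤1 1≤dM)
        ...     | inj₂ p≤∑ = inj₁ (≤-trans p≤∑
          (subst (λ xs → sum (map q xs) ≤ d * M) eq q-on-C))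

-- Counting paths to the sink by lists of edges

module Words
  (E : Digraph) (_≟_ : DecidableEquality (Vertex E)) (edges : List (Edge E))
  (complete : ∀ e → e ∈ edges) (w : Vertex E) (w-sink : IsSink E w)
  (⟵-wellFounded : WellFounded (λ u v → Digraph._⟶_ E v u))
  where

  open Digraph E using (Path; source; target)
  open Subharmonic E _≟_ edges ⟵-wellFounded

  -- words ℓ v lists the edge lists of the paths from v to w of length less
  -- than ℓ, and wordsVia ℓ es those of the paths that start with an edge in es
  -- and continue with fewer than ℓ edges to w.
  words : ℕ → Vertex E → List (List (Edge E))

  wordsVia : ℕ → List (Edge E) → List (List (Edge E))
  wordsVia ℓ = concatMap (λ e → map (e ∷_) (words ℓ (target e)))

  words zero    v = []
  words (suc ℓ) v with v ≟ w
  ... | yes _ = [] ∷ []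
  ... | no  _ = wordsVia ℓ (out v)

  -- The number of paths from v to w of length less than ℓ.
  count : ℕ → Vertex E → ℕ
  count ℓ v = length (words ℓ v)

  length-wordsVia : ∀ ℓ es → length (wordsVia ℓ es) ≡ sum (map (count ℓ ∘ target) es)
  length-wordsVia ℓ []       = refl
  length-wordsVia ℓ (e ∷ es) = trans (length-++ (map (e ∷_) (words ℓ (target e))))
    (cong₂ _+_ (length-map {B = List (Edge E)} (e ∷_) (words ℓ (target e))) (length-wordsVia ℓ es))

  count-mono : ∀ ℓ v → count ℓ v ≤ count (suc ℓ) v
  count-mono zero    v = z≤n
  count-mono (suc ℓ) v with v ≟ w
  ... | yes _ = ≤-refl
  ... | no  _ = subst₂ _≤_ (sym (length-wordsVia ℓ (out v)))
    (sym (length-wordsVia (suc ℓ) (out v)))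
    (sum-map-≤ (λ e → count-mono ℓ (target e)) (out v))

  count-subharmonic : ∀ ℓ v →
    count ℓ v ≤ 1 ⊎ count ℓ v ≤ sum (map (count ℓ ∘ target) (out v))
  count-subharmonic zero    v = inj₁ z≤n
  count-subharmonic (suc ℓ) v with v ≟ w
  ... | yes _ = inj₁ ≤-refl
  ... | no  _ = inj₂ (≤-trans (≤-reflexive (length-wordsVia ℓ (out v)))
    (sum-map-≤ (λ e → count-mono ℓ (target e)) (out v)))

  -- The edge lists of all paths to w of length at most ℓ; the empty one stands
  -- for the path of length 0 at w.
  allWords : ℕ → List (List (Edge E))
  allWords ℓ = [] ∷ wordsVia ℓ edges

  length-allWords : ∀ ℓ → length (allWords ℓ) ≤ maxPaths (length edges)
  length-allWords ℓ = begin
    1 + length (wordsVia ℓ edges)               ≡⟨ cong suc (length-wordsVia ℓ edges) ⟩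
    1 + sum (map (count ℓ ∘ target) edges)      ≡⟨ +-comm 1 _ ⟩
    sum (map (count ℓ ∘ target) edges) + 1
      ≤⟨ total-bound (count ℓ) (count-subharmonic ℓ) edges 1 ≤-refl (λ _ → inj₂ refl) ⟩
    1 * maxPaths (length edges)                 ≡⟨ *-identityˡ _ ⟩
    maxPaths (length edges)                     ∎
    where open ≤-Reasoning

  -- The starting vertex of a path need not be recorded: it is the source of
  -- the first edge, or w if there is none.
  word : ∀ {v} → Path v w → List (Edge E)
  word ε             = []
  word ((e , _) ◅ p) = e ∷ word p

  word-injective : ∀ {u v} (p : Path u w) (q : Path v w) → word p ≡ word q →
                   _≡_ {A = PathEndingAt E w} (u , p) (v , q)
  word-injective ε ε _ = refl
  word-injective ((e , refl , refl) ◅ p) ((f , refl , refl) ◅ q) eq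
    with ∷-injective eq
  ... | refl , eq′ with word-injective p q eq′
  ...   | refl = refl

  wordsVia-∈ : ∀ ℓ {e es s} → e ∈ es → s ∈ words ℓ (target e) → e ∷ s ∈ wordsVia ℓ es
  wordsVia-∈ ℓ {e} e∈es s∈ = ∈-concatMap⁺ _ (lose e∈es (∈-map⁺ (e ∷_) s∈))

  word-∈ : ∀ ℓ {v} (p : Path v w) → length (word p) < ℓ → word p ∈ words ℓ v
  word-∈ (suc ℓ) ε _ with w ≟ w
  ... | yes _   = here refl
  ... | no  w≢w = contradiction refl w≢w
  word-∈ (suc ℓ) ((e , refl , refl) ◅ p) (s≤s p<ℓ) with source e ≟ w
  ... | yes e-from-w = contradiction (e , e-from-w) w-sink
  ... | no  _        =
    wordsVia-∈ ℓ (∈-filter⁺ (from? (source e)) (complete e) refl) (word-∈ ℓ p p<ℓ)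

  word-∈-all : ∀ ℓ {v} (p : Path v w) → length (word p) ≤ ℓ → word p ∈ allWords ℓ
  word-∈-all ℓ ε                       _   = here refl
  word-∈-all ℓ ((e , refl , refl) ◅ p) p<ℓ =
    there (wordsVia-∈ ℓ (complete e) (word-∈ ℓ p p<ℓ))

  paths-bound : ∀ m → Fin m ↣ PathEndingAt E w → m ≤ maxPaths (length edges)
  paths-bound m f = ≤-trans (injective⇒≤ index-inj) (length-allWords ℓ)
    where
    open Injection f using (to; injective)

    code : Fin m → List (Edge E)
    code i = word (proj₂ (to i))

    lengths = tabulate (length ∘ code)

    ℓ = max 0 lengths

    code-∈ : ∀ i → code i ∈ allWords ℓ
    code-∈ i = word-∈-all ℓ (proj₂ (to i)) (tabulate⁻ (xs≤max 0 lengths) i)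

    index-inj : ∀ {i j} → Any.index (code-∈ i) ≡ Any.index (code-∈ j) → i ≡ j
    index-inj {i} {j} eq = injective
      (word-injective (proj₂ (to i)) (proj₂ (to j))
        (index-injective (setoid _) (code-∈ i) (code-∈ j) eq))

-- The upper bound for admissible graphs

listed⇒¬¬decidable : (xs : List A) → (∀ x → x ∈ xs) → ¬ ¬ DecidableEquality A
listed⇒¬¬decidable xs listed = ¬¬-map
  (λ all x y → All.lookup (All.lookup all (listed x)) (listed y))
  (sequence (All.universal (λ x → sequence (All.universal (λ y → ¬¬-excluded-middle) xs)) xs))
  where
  sequence : {P : Pred _ _} {ys : List _} → All (λ y → ¬ ¬ P y) ys → ¬ ¬ All P ys
  sequence = All.sequenceM _ ¬¬-Monad

upper-bound : ∀ {N} (E : Digraph) (a : Admissible N E) m →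
              Fin m ↣ PathEndingAt E (sink a) → m ≤ maxPaths N
upper-bound {N} E a m f = decidable-stable (m ≤? maxPaths N)
  (¬¬-map bound (listed⇒¬¬decidable vertices vertex-listed))
  where
  open Digraph E using (source; target)
  open Admissible a using (edges; connected; acyclic; oneSink)
  open Inverse edges using (to; from; strictlyInverseˡ)

  edgeList : List (Edge E)
  edgeList = tabulate to

  edge-listed : ∀ e → e ∈ edgeList
  edge-listed e = subst (_∈ edgeList) (strictlyInverseˡ e) (∈-tabulate⁺ (from e))

  vertices : List (Vertex E)
  vertices = sink a ∷ map source edgeList ++ map target edgeList

  vertex-listed : ∀ v → v ∈ vertices
  vertex-listed v with connected v (sink a)
  ... | ε                      = here refl
  ... | fwd (e , refl , _) ◅ _ = there (∈-++⁺ˡ (∈-map⁺ source (edge-listed e)))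
  ... | bwd (e , _ , refl) ◅ _ =
    there (∈-++⁺ʳ (map source edgeList) (∈-map⁺ target (edge-listed e)))

  bound : DecidableEquality (Vertex E) → m ≤ maxPaths N
  bound _≟_ = subst (λ n → m ≤ maxPaths n) (length-tabulate to)
    (Words.paths-bound E _≟_ edgeList edge-listed (sink a) (proj₁ (proj₂ oneSink))
      (WellFoundedness.⟵-wellFounded E edges acyclic) m f)

-- Attaining the bound

-- The graph obtained from E by adding a new vertex, `nothing`, and d parallel
-- edges to it from w.  It is used when w is the sink of E and d ≥ 1.
module AddSink (E : Digraph) (w : Vertex E) (d : ℕ) where

  open Digraph E using (_⟶_; Path; source; target)

  graph : Digraph
  graph = record
    { Vertex = Maybe (Vertex E)
    ; Edge   = Fin d ⊎ Edge E
    ; source = λ { (inj₁ _) → just w ; (inj₂ e) → just (source e) }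
    ; target = λ { (inj₁ _) → nothing ; (inj₂ e) → just (target e) }
    }

  module G = Digraph graph

  lift-⟶ : ∀ {u v} → u ⟶ v → just u G.⟶ just v
  lift-⟶ (e , refl , refl) = inj₂ e , refl , refl

  nothing-sink : IsSink graph nothing
  nothing-sink (inj₁ _ , ())
  nothing-sink (inj₂ _ , ())

  no-path-from-nothing : ∀ {v} → ¬ TransClosure G._⟶_ nothing v
  no-path-from-nothing [ e , e-from-nothing , _ ]   = nothing-sink (e , e-from-nothing)
  no-path-from-nothing ((e , e-from-nothing , _) ∷ _) = nothing-sink (e , e-from-nothing)

  lower-⟶⁺ : ∀ {u v} → TransClosure G._⟶_ (just u) (just v) → TransClosure _⟶_ u v
  lower-⟶⁺ [ inj₂ e , refl , refl ]   = [ e , refl , refl ]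
  lower-⟶⁺ ((inj₁ _ , refl , refl) ∷ p) = contradiction p no-path-from-nothing
  lower-⟶⁺ ((inj₂ e , refl , refl) ∷ p) = (e , refl , refl) ∷ lower-⟶⁺ p

  graph-acyclic : Acyclic E → Acyclic graph
  graph-acyclic acyclic nothing  = no-path-from-nothing
  graph-acyclic acyclic (just v) = acyclic v ∘ lower-⟶⁺

  graph-connected : Fin d → Connected E → Connected graph
  graph-connected i connected u v =
    EqClosure.transitive G._⟶_ (to-sink u) (EqClosure.symmetric G._⟶_ (to-sink v))
    where
    to-sink : ∀ u → EqClosure G._⟶_ u nothing
    to-sink nothing  = ε
    to-sink (just u) = EqClosure.transitive G._⟶_
      (EqClosure.gmap just lift-⟶ (connected u w))
      (fwd (inj₁ i , refl , refl) ◅ ε)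

  graph-oneSink : Fin d → (∀ {v} → IsSink E v → w ≡ v) → ∃! _≡_ (IsSink graph)
  graph-oneSink i unique = nothing , nothing-sink , λ {v} → nothing-only v
    where
    nothing-only : ∀ v → IsSink graph v → nothing ≡ v
    nothing-only nothing  _      = refl
    -- An old vertex that is a sink here is a sink of E, so it is w; but w
    -- emits a new edge.
    nothing-only (just v) v-sink = contradiction
      (inj₁ i , cong just (unique λ (e , e-from-v) → v-sink (inj₂ e , cong just e-from-v)))
      v-sink

  -- A path from an old vertex to the new sink is a path to w followed by one of
  -- the d new edges.
  down : ∀ {u} → G.Path (just u) nothing → Fin d × Path u w
  down ((inj₁ i , refl , refl) ◅ _) = i , ε
  down ((inj₂ e , refl , refl) ◅ p) = proj₁ (down p) , (e , refl , refl) ◅ proj₂ (down p)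

  up : ∀ {u} → Fin d → Path u w → G.Path (just u) nothing
  up i ε                       = (inj₁ i , refl , refl) ◅ ε
  up i ((e , refl , refl) ◅ p) = (inj₂ e , refl , refl) ◅ up i p

  down-up : ∀ {u} i (p : Path u w) → down (up i p) ≡ (i , p)
  down-up i ε                       = refl
  down-up i ((e , refl , refl) ◅ p) rewrite down-up i p = refl

  up-down : ∀ {u} (p : G.Path (just u) nothing) → up (proj₁ (down p)) (proj₂ (down p)) ≡ p
  up-down ((inj₁ i , refl , refl) ◅ ε)                  = refl
  up-down ((inj₁ i , refl , refl) ◅ ((inj₁ _ , () , _) ◅ _))
  up-down ((inj₁ i , refl , refl) ◅ ((inj₂ _ , () , _) ◅ _))
  up-down ((inj₂ e , refl , refl) ◅ p)                  =
    cong ((inj₂ e , refl , refl) ◅_) (up-down p)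

  paths↔ : (Fin 1 ⊎ (Fin d × PathEndingAt E w)) ↔ PathEndingAt graph nothing
  paths↔ = mk↔ₛ′ to from to-from from-to
    where
    to : Fin 1 ⊎ (Fin d × PathEndingAt E w) → PathEndingAt graph nothing
    to (inj₁ zero)        = nothing , ε
    to (inj₂ (i , u , p)) = just u , up i p

    from : PathEndingAt graph nothing → Fin 1 ⊎ (Fin d × PathEndingAt E w)
    from (nothing , _) = inj₁ zero
    from (just u , p)  = inj₂ (proj₁ (down p) , u , proj₂ (down p))

    to-from : ∀ x → to (from x) ≡ x
    to-from (nothing , ε) = refl
    to-from (nothing , (inj₁ _ , () , _) ◅ _)
    to-from (nothing , (inj₂ _ , () , _) ◅ _)
    to-from (just u , p)  = cong (just u ,_) (up-down p)

    from-to : ∀ x → from (to x) ≡ x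
    from-to (inj₁ zero)        = refl
    from-to (inj₂ (i , u , p)) = cong (λ (j , q) → inj₂ (j , u , q)) (down-up i p)

-- Some admissible graph with N edges has exactly M paths ending in its sink.
Attained : ℕ → ℕ → Set₁
Attained N M = Σ Digraph λ E → Σ (Admissible N E) λ a → Fin M ↔ PathEndingAt E (sink a)

attained-0 : Attained 0 1
attained-0 = E , a , mk↔ₛ′ (λ _ → tt , ε) (λ _ → zero)
                   (λ { (_ , ε) → refl ; (_ , (() , _) ◅ _) }) (λ { zero → refl })
  where
  E : Digraph
  E = record { Vertex = ⊤ ; Edge = Fin 0 ; source = λ () ; target = λ () }
  a : Admissible 0 E
  a = record
    { edges     = ↔-refl
    ; connected = λ _ _ → ε
    ; acyclic   = λ { _ [ () , _ ] ; _ ((() , _) ∷ _) }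
    ; oneSink   = tt , (λ { (() , _) }) , λ _ → refl
    }

attained-+ : ∀ d {N M} → Attained N M → Attained (suc d + N) (1 + suc d * M)
attained-+ d (E , a , M↔paths) = graph , a′ ,
  ↔-trans (+↔⊎ {1}) (↔-trans (↔-refl ⊎-↔ ↔-trans *↔× (↔-refl ×-↔ M↔paths)) paths↔)
  where
  open AddSink E (sink a) (suc d)
  open Admissible a
  a′ : Admissible _ graph
  a′ = record
    { edges     = ↔-trans (+↔⊎ {suc d}) (↔-refl ⊎-↔ edges)
    ; connected = graph-connected zero connected
    ; acyclic   = graph-acyclic acyclic
    ; oneSink   = graph-oneSink zero (proj₂ (proj₂ oneSink))
    }

maxPaths-attained : ∀ N → Attained N (maxPaths N)
maxPaths-attained 0 = attained-0
maxPaths-attained 1 = attained-+ 0 (maxPaths-attained 0)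
maxPaths-attained 2 = attained-+ 1 (maxPaths-attained 0)
maxPaths-attained 3 = attained-+ 1 (maxPaths-attained 1)
maxPaths-attained 4 = attained-+ 1 (maxPaths-attained 2)
maxPaths-attained 5 = attained-+ 1 (maxPaths-attained 3)
maxPaths-attained 6 = attained-+ 2 (maxPaths-attained 3)
maxPaths-attained 7 = attained-+ 1 (maxPaths-attained 5)
maxPaths-attained (suc (suc (suc n@(suc (suc (suc (suc (suc _)))))))) =
  attained-+ 2 (maxPaths-attained n)

maxPaths-isMax : ∀ N → IsMaxPathsToSink N (maxPaths N)
maxPaths-isMax N = record { attained = maxPaths-attained N ; bounded = upper-bound }

theorem4p12 : (N : ℕ) → 5 ≤ N → (k : ℕ) (i : Fin 3) → N ≡ 3 * k + toℕ i → IsMaxPathsToSink N (maxPathsFormula k i)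
theorem4p12 N 5≤N k i refl =
  subst (IsMaxPathsToSink N) (maxPaths≡formula k i 5≤N) (maxPaths-isMax N)
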